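{- If $G$ is a $k$-tree, then the number of clique trees of $G$ equals the number of spanning trees of the reduced clique graph $C_r(G)$.
   Context: A $k$-tree: $K_{k+1}$ is a $k$-tree, and adding to a $k$-tree a new vertex adjacent exactly to the vertices of a $k$-clique gives a $k$-tree. The clique-intersection graph of a connected chordal graph $G$ has the maximal cliques of $G$ as vertices, edges between intersecting maximal cliques, weighted by $|Q\cap Q'|$; a clique tree of $G$ is a maximum-weight spanning tree of it. Maximal cliques $Q,Q'$ form a separating pair if $Q\cap Q'\ne\emptyset$ and every path in $G$ from $Q\setminus Q'$ to $Q'\setminus Q$ contains a vertex of $Q\cap Q'$; the reduced clique graph $C_r(G)$ has the maximal cliques of $G$ as vertices, two adjacent iff they form a separating pair. -}

module Defs where

open import Data.Bool using (Bool; true; false; if_then_else_)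
open import Data.Nat using (ℕ; zero; suc; _≤_)
open import Data.Fin using (Fin; punchIn)
open import Data.Fin.Subset using (Subset; _∈_; _⊆_; _∩_; ∣_∣; Nonempty; inside; outside)
open import Data.Vec using (Vec; []; _∷_)
open import Data.List using (List; []; _∷_; [_]; map; _++_; length; cartesianProductWith)
open import Data.Nat.ListAction using (sum)
open import Data.List.Relation.Unary.All using (All)
open import Data.List.Relation.Unary.Any using (Any)
open import Data.List.Relation.Unary.AllPairs using (AllPairs)
open import Data.List.Relation.Unary.Unique.Propositional using (Unique)
open import Data.Product using (Σ; ∃; _×_; _,_)
open import Data.Empty using (⊥)
open import Relation.Nullary using (¬_)
open import Relation.Binary.PropositionalEquality using (_≡_; _≢_)

record Graph (n : ℕ) : Set where
  field
    adj    : Fin n → Fin n → Bool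
    sym    : ∀ i j → adj i j ≡ adj j i
    irrefl : ∀ i → adj i i ≡ false
open Graph public

Edge : ∀ {n} → Graph n → Fin n → Fin n → Set
Edge G i j = adj G i j ≡ true

delete : ∀ {n} → Fin (suc n) → Graph (suc n) → Graph n
delete v G = record
  { adj    = λ i j → adj G (punchIn v i) (punchIn v j)
  ; sym    = λ i j → sym G (punchIn v i) (punchIn v j)
  ; irrefl = λ i → irrefl G (punchIn v i)
  }

IsClique : ∀ {n} → Graph n → Subset n → Set
IsClique G S = ∀ i j → i ∈ S → j ∈ S → i ≢ j → Edge G i j

IsMaxClique : ∀ {n} → Graph n → Subset n → Set
IsMaxClique G S = IsClique G S × (∀ S′ → IsClique G S′ → S ⊆ S′ → S′ ≡ S)

data IsKTree (k : ℕ) : {n : ℕ} → Graph n → Set where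
  base : (G : Graph (suc k)) → (∀ i j → i ≢ j → Edge G i j) → IsKTree k G
  step : ∀ {n} (G : Graph (suc n)) (v : Fin (suc n)) (S : Subset n) →
         IsKTree k (delete v G) →
         IsClique (delete v G) S → ∣ S ∣ ≡ k →
         (∀ i → (Edge G v (punchIn v i) → i ∈ S) × (i ∈ S → Edge G v (punchIn v i))) →
         IsKTree k G

data Walk {V : Set} (R : V → V → Set) : V → V → List V → Set where
  here : ∀ x → Walk R x x [ x ]
  step : ∀ {x y z vs} → R x y → Walk R y z vs → Walk R x z (x ∷ vs)

Path : {V : Set} (R : V → V → Set) → V → V → List V → Set
Path R x y vs = Walk R x y vs × Unique vs

SeparatingPair : ∀ {n} → Graph n → Subset n → Subset n → Set
SeparatingPair G Q Q′ =
  Nonempty (Q ∩ Q′) ×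
  (∀ x y vs → x ∈ Q → ¬ (x ∈ Q′) → y ∈ Q′ → ¬ (y ∈ Q) →
     Path (Edge G) x y vs → Any (λ z → z ∈ (Q ∩ Q′)) vs)

CIAdj : ∀ {n} → Graph n → Subset n → Subset n → Set
CIAdj G Q Q′ = IsMaxClique G Q × IsMaxClique G Q′ × Q ≢ Q′ × Nonempty (Q ∩ Q′)

CrAdj : ∀ {n} → Graph n → Subset n → Subset n → Set
CrAdj G Q Q′ = IsMaxClique G Q × IsMaxClique G Q′ × Q ≢ Q′ × SeparatingPair G Q Q′

-- Edge sets of graphs whose vertices are subsets of Fin n, given as
-- symmetric Boolean relations; equal when extensionally equal.

EdgeSet : ℕ → Set
EdgeSet n = Subset n → Subset n → Bool

_≐_ : ∀ {n} → EdgeSet n → EdgeSet n → Set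
T ≐ T′ = ∀ Q Q′ → T Q Q′ ≡ T′ Q Q′

TEdge : ∀ {n} → EdgeSet n → Subset n → Subset n → Set
TEdge T Q Q′ = T Q Q′ ≡ true

-- spanning tree of the graph with vertex set {Q | Vtx Q} and adjacency Adj
-- (Adj Q Q′ is assumed to imply Vtx Q and Vtx Q′)
IsSpanningTree : ∀ {n} → (Subset n → Set) → (Subset n → Subset n → Set) → EdgeSet n → Set
IsSpanningTree Vtx Adj T =
  (∀ Q Q′ → TEdge T Q Q′ → Adj Q Q′) ×
  (∀ Q Q′ → T Q Q′ ≡ T Q′ Q) ×
  (∀ Q Q′ → Vtx Q → Vtx Q′ → ∃ λ vs → Walk (TEdge T) Q Q′ vs) ×
  -- acyclic: no cycle x = v₀, v₁, …, vₘ (distinct, m ≥ 2), vₘ adjacent to v₀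
  (∀ x y vs → Path (TEdge T) x y vs → 3 ≤ length vs → ¬ TEdge T y x)

allSubsets : ∀ n → List (Subset n)
allSubsets zero    = [ [] ]
allSubsets (suc n) = map (outside ∷_) (allSubsets n) ++ map (inside ∷_) (allSubsets n)

-- weight of T in the clique-intersection graph: Σ over edges of |Q ∩ Q′|.
-- Each edge is counted twice (once per ordering), which does not affect
-- comparisons of weights.
weight2 : ∀ {n} → EdgeSet n → ℕ
weight2 {n} T = sum (cartesianProductWith (λ Q Q′ → if T Q Q′ then ∣ Q ∩ Q′ ∣ else 0)
                                          (allSubsets n) (allSubsets n))

IsCliqueTree : ∀ {n} → Graph n → EdgeSet n → Set
IsCliqueTree G T =
  IsSpanningTree (IsMaxClique G) (CIAdj G) T ×
  (∀ T′ → IsSpanningTree (IsMaxClique G) (CIAdj G) T′ → weight2 T′ ≤ weight2 T)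

IsCrSpanningTree : ∀ {n} → Graph n → EdgeSet n → Set
IsCrSpanningTree G T = IsSpanningTree (IsMaxClique G) (CrAdj G) T

HasCount : ∀ {n} → (EdgeSet n → Set) → ℕ → Set
HasCount {n} P c = Σ (List (EdgeSet n)) λ L →
  length L ≡ c × All P L × AllPairs (λ T T′ → ¬ (T ≐ T′)) L ×
  (∀ T → P T → Any (λ T′ → T ≐ T′) L)

{-# OPTIONS --safe #-}
-- In a k-tree the maximal cliques are the (k+1)-cliques, so two of them share
-- at most k vertices.  They form a separating pair iff they share exactly k ≥ 1
-- vertices: sharing k suffices because k-trees are built by adding simplicial
-- vertices, and fewer shared vertices cannot separate because the (k+1)-cliques
-- are connected through steps that share k vertices.  All edges of C_r(G) thus
-- have the largest possible weight k, and since all trees on the maximal cliques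
-- have the same number of edges, the maximum-weight spanning trees are exactly
-- the spanning trees of C_r(G).
module Submission where

open import Defs
open import Data.Bool using (Bool; true; false; if_then_else_; _∧_)
import Data.Bool.Properties as Bool
open import Data.Empty using (⊥; ⊥-elim)
open import Data.Fin using (Fin; zero; suc; punchIn; punchOut)
import Data.Fin.Properties as Fin
open import Data.Fin.Subset using (Subset; _∈_; _∉_; _⊆_; _∩_; _∪_; ⁅_⁆; ⊤; ∣_∣; Nonempty; inside; outside) renaming (⊥ to ∅)
open import Data.Fin.Subset.Properties
open import Data.List using (List; []; _∷_; [_]; map; _++_; length; filter; deduplicate; cartesianProductWith)
import Data.List.Properties as List
import Data.List.Membership.DecPropositional as DecMembership
open import Data.List.Membership.Propositional using () renaming (_∈_ to _∈ˡ_; _∉_ to _∉ˡ_)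
import Data.List.Membership.Propositional.Properties as Membership
import Data.List.Membership.Setoid.Properties as SetoidMembership
open import Data.List.Relation.Unary.All as All using (All; []; _∷_)
import Data.List.Relation.Unary.All.Properties as All
open import Data.List.Relation.Unary.AllPairs using ([]; _∷_)
open import Data.List.Relation.Unary.Any as Any using (Any; here; there)
import Data.List.Relation.Unary.Any.Properties as Any
open import Data.List.Relation.Unary.Unique.DecSetoid.Properties using (deduplicate-!)
open import Data.Nat using (ℕ; zero; suc; _+_; _*_; _≤_; _<_; z≤n; s≤s)
open import Data.Nat.ListAction using (sum)
open import Data.Nat.ListAction.Properties using (sum-++)
import Data.Nat.Properties as ℕ
open import Algebra.Properties.CommutativeSemigroup ℕ.+-commutativeSemigroup using () renaming (interchange to +-interchange)
open import Data.Product using (∃; _×_; _,_; -,_; proj₁; proj₂)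
open import Data.Sum using (_⊎_; inj₁; inj₂)
open import Data.Vec using ([]; _∷_; insertAt; removeAt; lookup)
import Data.Vec.Properties as Vec
open import Function using (_∘_; id)
open import Level using (0ℓ)
open import Relation.Binary using (DecidableEquality; DecSetoid)
import Relation.Binary as Binary
open import Relation.Binary.Construct.Closure.ReflexiveTransitive as Star using (Star; ε; _◅_; _◅◅_)
open import Relation.Binary.PropositionalEquality using (_≡_; _≢_; refl; trans; cong; cong₂; subst; subst₂; module ≡-Reasoning) renaming (sym to ≡-sym)
open import Relation.Nullary using (¬_; Dec; yes; no; does; contradiction; map′; ¬?; _×-dec_; _⊎-dec_; _→-dec_)
open import Relation.Nullary.Decidable using (dec-true; dec-false; decidable-stable)
open import Relation.Unary using (Decidable)

-- Walks

-- `HasCount` asks for an explicit list without repetitions up to `_≐_`, so some property of edge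
-- sets has to be decided. Clique trees and spanning trees of C_r(G) are therefore both shown to be
-- the trees satisfying one decidable property, `IsLinkTree`, and these are counted once. Comparing
-- weights also needs a tree that attains weight k on every edge; otherwise the bound k per edge
-- could be out of reach. It comes from the construction of G: each new vertex creates a single new
-- (k+1)-clique, hung as a leaf on an older one that contains its neighbourhood. The same tree
-- supplies the chains of cliques along which a set of fewer than k vertices can be bypassed. Edge
-- counts agree because, after rooting, edges correspond to the vertices other than the root. For k
-- = 0 disjoint cliques share k vertices, so nonempty intersection has to be carried along
-- separately.

infix 5 _∖_

-- Only the ends of steps are constrained, so the empty walk is allowed even at a vertex satisfying
-- P. This is why `walk∖⇒all` and `star⇒path∖` ask for `¬ P x` in addition.
_∖_ : {V : Set} → (V → V → Set) → (V → Set) → V → V → Set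
(R ∖ P) x y = R x y × ¬ P x × ¬ P y

module _ {V : Set} {R : V → V → Set} where

  walk⇒star : ∀ {x y vs} → Walk R x y vs → Star R x y
  walk⇒star (here _)   = ε
  walk⇒star (step r w) = r ◅ walk⇒star w

  star⇒walk : ∀ {x y} → Star R x y → ∃ (Walk R x y)
  star⇒walk ε       = -, here _
  star⇒walk (r ◅ s) = -, step r (proj₂ (star⇒walk s))

  walk-end : ∀ {x y vs} → Walk R x y vs → y ∈ˡ vs
  walk-end (here _)   = here refl
  walk-end (step _ w) = there (walk-end w)

  walk-map : ∀ {R′ : V → V → Set} → (∀ {x y} → R x y → R′ x y) → ∀ {x y vs} → Walk R x y vs → Walk R′ x y vs
  walk-map f (here x)   = here x
  walk-map f (step r w) = step (f r) (walk-map f w)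

  module _ {P : V → Set} where

    walk⇒star∖ : ∀ {x y vs} → Walk R x y vs → All (¬_ ∘ P) vs → Star (R ∖ P) x y
    walk⇒star∖ (here _)            _            = ε
    walk⇒star∖ (step r (here _))   (p ∷ q ∷ ps) = (r , p , q) ◅ ε
    walk⇒star∖ (step r w@(step _ _)) (p ∷ q ∷ ps) = (r , p , q) ◅ walk⇒star∖ w (q ∷ ps)

    walk∖⇒all : ∀ {x y vs} → ¬ P x → Walk (R ∖ P) x y vs → All (¬_ ∘ P) vs
    walk∖⇒all p (here _)                 = p ∷ []
    walk∖⇒all p (step (_ , _ , q) w) = p ∷ walk∖⇒all q w

    forget : ∀ {x y} → Star (R ∖ P) x y → Star R x y
    forget = Star.map proj₁

    ∖-reverse : (∀ {x y} → R x y → R y x) → ∀ {x y} → Star (R ∖ P) x y → Star (R ∖ P) y x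
    ∖-reverse symR = Star.reverse λ { (r , p , q) → symR r , q , p }

module _ {V : Set} (_≟_ : DecidableEquality V) where
  open DecMembership _≟_ using () renaming (_∈?_ to _∈ˡ?_)

  suffix : ∀ {R : V → V → Set} {x y z vs} → Path R y z vs → x ∈ˡ vs → ∃ (Path R x z)
  suffix p@(here _ , _)     (here refl) = -, p
  suffix p@(step _ _ , _)   (here refl) = -, p
  suffix (step _ w , _ ∷ u) (there x∈)  = suffix (w , u) x∈

  -- Loop erasure: if the new first vertex already lies on the path, only the part from there on is
  -- kept.
  star⇒path : ∀ {R : V → V → Set} {x y} → Star R x y → ∃ (Path R x y)
  star⇒path ε = -, here _ , [] ∷ []
  star⇒path {x = x} (r ◅ s) with star⇒path s
  ... | vs , w , u with x ∈ˡ? vs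
  ...   | yes x∈ = suffix (w , u) x∈
  ...   | no  x∉ = -, step r w , All.¬Any⇒All¬ vs x∉ ∷ u

  star⇒path∖ : ∀ {R : V → V → Set} {P x y} → ¬ P x → Star (R ∖ P) x y →
               ∃ λ vs → Path R x y vs × All (¬_ ∘ P) vs
  star⇒path∖ p s with star⇒path s
  ... | vs , w , u = vs , (walk-map proj₁ w , u) , walk∖⇒all p w

  -- Cut a walk to r after its last visit to x.
  lastExit : ∀ {R : V → V → Set} {r s} x → x ≢ r → Star R s r →
             (x ≢ s × Star (R ∖ (x ≡_)) s r) ⊎ ∃ λ y → R x y × x ≢ y × Star (R ∖ (x ≡_)) y r
  lastExit x x≢r ε = inj₁ (x≢r , ε)
  lastExit x x≢r (_◅_ {i = s} r p) with lastExit x x≢r p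
  ... | inj₂ e = inj₂ e
  ... | inj₁ (x≢y , q) with x ≟ s
  ...   | yes refl = inj₂ (-, r , x≢y , q)
  ...   | no  x≢s  = inj₁ (x≢s , (r , x≢s , x≢y) ◅ q)

-- The Floyd–Warshall recursion: interior vertices are taken from the list.
Reach : {V : Set} → (V → V → Set) → List V → V → V → Set
Reach R []       x y = x ≡ y ⊎ R x y
Reach R (v ∷ vs) x y = Reach R vs x y ⊎ (Reach R vs x v × Reach R vs v y)

module _ {V : Set} {R : V → V → Set} where

  reach⇒star : ∀ vs {x y} → Reach R vs x y → Star R x y
  reach⇒star []       (inj₁ refl)    = ε
  reach⇒star []       (inj₂ r)       = r ◅ ε
  reach⇒star (v ∷ vs) (inj₁ p)       = reach⇒star vs p
  reach⇒star (v ∷ vs) (inj₂ (p , q)) = reach⇒star vs p ◅◅ reach⇒star vs q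

  reach-refl : ∀ vs {x} → Reach R vs x x
  reach-refl []       = inj₁ refl
  reach-refl (v ∷ vs) = inj₁ (reach-refl vs)

  reach-edge : ∀ vs {x y} → R x y → Reach R vs x y
  reach-edge []       r = inj₂ r
  reach-edge (v ∷ vs) r = inj₁ (reach-edge vs r)

  -- If both pieces pass through the head v, the closed detour from v via y back to v is dropped.
  -- Membership of y in the list is what allows y itself to become an interior vertex.
  reach-trans : ∀ {vs x y z} → y ∈ˡ vs → Reach R vs x y → Reach R vs y z → Reach R vs x z
  reach-trans (here refl) p q = inj₂ (to-head p , from-head q)
    where
    to-head : ∀ {v vs x} → Reach R (v ∷ vs) x v → Reach R vs x v
    to-head (inj₁ p)       = p
    to-head (inj₂ (p , _)) = p
    from-head : ∀ {v vs x} → Reach R (v ∷ vs) v x → Reach R vs v x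
    from-head (inj₁ p)       = p
    from-head (inj₂ (_ , p)) = p
  reach-trans (there y∈) (inj₁ p)       (inj₁ q)       = inj₁ (reach-trans y∈ p q)
  reach-trans (there y∈) (inj₁ p)       (inj₂ (q , s)) = inj₂ (reach-trans y∈ p q , s)
  reach-trans (there y∈) (inj₂ (p , q)) (inj₁ s)       = inj₂ (p , reach-trans y∈ q s)
  reach-trans (there y∈) (inj₂ (p , _)) (inj₂ (_ , q)) = inj₂ (p , q)

  star⇒reach : ∀ {vs} → (∀ v → v ∈ˡ vs) → ∀ {x y} → Star R x y → Reach R vs x y
  star⇒reach {vs} all∈ ε       = reach-refl vs
  star⇒reach {vs} all∈ (r ◅ s) = reach-trans (all∈ _) (reach-edge vs r) (star⇒reach all∈ s)

  module _ (_≟_ : DecidableEquality V) (R? : Binary.Decidable R) where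

    reach? : ∀ vs → Binary.Decidable (Reach R vs)
    reach? []       x y = x ≟ y ⊎-dec R? x y
    reach? (v ∷ vs) x y = reach? vs x y ⊎-dec (reach? vs x v ×-dec reach? vs v y)

    star? : ∀ {vs} → (∀ v → v ∈ˡ vs) → Binary.Decidable (Star R)
    star? {vs} all∈ x y = map′ (reach⇒star vs) (star⇒reach all∈) (reach? vs x y)

-- Trees

-- A cycle through z with z cut out is a walk, off z, between two different neighbours of z. This
-- form mentions no vertex lists, so it is decidable as soon as reachability is.
Acyclic : {V : Set} → (V → V → Set) → Set
Acyclic R = ∀ {z a b} → R z a → R z b → a ≢ b → ¬ Star (R ∖ (z ≡_)) a b

NoCycle : {V : Set} → (V → V → Set) → Set
NoCycle R = ∀ x y vs → Path R x y vs → 3 ≤ length vs → ¬ R y x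

record IsTree {V : Set} (Vtx : V → Set) (R : V → V → Set) : Set where
  constructor mkTree
  field
    source    : ∀ {x y} → R x y → Vtx x
    symmetric : ∀ {x y} → R x y → R y x
    irr       : ∀ {x} → ¬ R x x
    connected : ∀ {x y} → Vtx x → Vtx y → Star R x y
    acyclic   : Acyclic R

module _ {V : Set} {R : V → V → Set} (symR : ∀ {x y} → R x y → R y x) where

  acyclic⇒noCycle : Acyclic R → NoCycle R
  acyclic⇒noCycle ac x y _ (here _ , _) (s≤s ())
  acyclic⇒noCycle ac x y _ (step _ (here _) , _) (s≤s (s≤s ()))
  acyclic⇒noCycle ac x y _ (step r w@(step _ w′) , x≢ ∷ (a≢ ∷ _)) _ yx =
    ac r (symR yx) (All.lookup a≢ (walk-end w′)) (walk⇒star∖ w x≢)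

  -- Loop erasure turns the walk from a to b off z into a path, which z closes to a cycle; `a ≢ b`
  -- guarantees the three vertices.
  noCycle⇒acyclic : DecidableEquality V → (∀ {x} → ¬ R x x) → NoCycle R → Acyclic R
  noCycle⇒acyclic _≟_ irr nc {z} {a} {b} za zb a≢b s
    with star⇒path∖ _≟_ (λ { refl → irr za }) s
  ... | vs , (w , u) , z≢ = nc z b (z ∷ vs) (step za w , z≢ ∷ u) (s≤s (long w)) (symR zb)
    where
    long : ∀ {vs} → Walk R a b vs → 2 ≤ length vs
    long (here _)            = contradiction refl a≢b
    long (step _ (here _))   = s≤s (s≤s z≤n)
    long (step _ (step _ _)) = s≤s (s≤s z≤n)

tree-resp : {V : Set} {A B : V → Set} {R S : V → V → Set} →
            (∀ {x} → A x → B x) → (∀ {x} → B x → A x) →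
            (∀ {x y} → R x y → S x y) → (∀ {x y} → S x y → R x y) →
            IsTree A R → IsTree B S
tree-resp A⇒B B⇒A R⇒S S⇒R t = record
  { source    = A⇒B ∘ source ∘ S⇒R
  ; symmetric = R⇒S ∘ symmetric ∘ S⇒R
  ; irr       = irr ∘ S⇒R
  ; connected = λ a b → Star.map R⇒S (connected (B⇒A a) (B⇒A b))
  ; acyclic   = λ za zb a≢b s → acyclic (S⇒R za) (S⇒R zb) a≢b (Star.map (λ { (r , p) → S⇒R r , p }) s)
  }
  where open IsTree t

-- A growth history of a tree: the index lists its vertices, the newest leaf first, and `BuiltEdge`
-- reads off the edges.
data Built {V : Set} (Adj : V → V → Set) : List V → Set where
  root : ∀ r → Built Adj [ r ]
  leaf : ∀ {L} x y → x ∉ˡ L → y ∈ˡ L → Adj x y → Built Adj L → Built Adj (x ∷ L)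

module _ {V : Set} {Adj : V → V → Set} where

  BuiltEdge : ∀ {L} → Built Adj L → V → V → Set
  BuiltEdge (root r)           u w = ⊥
  BuiltEdge (leaf x y _ _ _ b) u w = BuiltEdge b u w ⊎ (u ≡ x × w ≡ y) ⊎ (u ≡ y × w ≡ x)

  builtEdge? : DecidableEquality V → ∀ {L} (b : Built Adj L) → Binary.Decidable (BuiltEdge b)
  builtEdge? _≟_ (root r)           u w = no λ ()
  builtEdge? _≟_ (leaf x y _ _ _ b) u w =
    builtEdge? _≟_ b u w ⊎-dec ((u ≟ x ×-dec w ≟ y) ⊎-dec (u ≟ y ×-dec w ≟ x))

  builtEdge⇒Adj : (∀ {x y} → Adj x y → Adj y x) → ∀ {L} (b : Built Adj L) {u w} → BuiltEdge b u w → Adj u w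
  builtEdge⇒Adj symA (leaf _ _ _ _ _ b) (inj₁ e)                    = builtEdge⇒Adj symA b e
  builtEdge⇒Adj symA (leaf _ _ _ _ a _) (inj₂ (inj₁ (refl , refl))) = a
  builtEdge⇒Adj symA (leaf _ _ _ _ a _) (inj₂ (inj₂ (refl , refl))) = symA a

  module _ {L x y} (b : Built Adj L) (x∉ : x ∉ˡ L) (y∈ : y ∈ˡ L) (a : Adj x y)
           (t : IsTree (_∈ˡ L) (BuiltEdge b)) where
    open IsTree t

    private
      R⁺ = BuiltEdge (leaf x y x∉ y∈ a b)

    leaf-symmetric : ∀ {u w} → R⁺ u w → R⁺ w u
    leaf-symmetric (inj₁ e)              = inj₁ (symmetric e)
    leaf-symmetric (inj₂ (inj₁ (p , q))) = inj₂ (inj₂ (q , p))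
    leaf-symmetric (inj₂ (inj₂ (p , q))) = inj₂ (inj₁ (q , p))

    leaf-nbr : ∀ {w} → R⁺ x w → w ≡ y
    leaf-nbr (inj₁ e)                    = contradiction (source e) x∉
    leaf-nbr (inj₂ (inj₁ (_ , w≡y)))     = w≡y
    leaf-nbr (inj₂ (inj₂ (refl , refl))) = refl

    old-edge : ∀ {u w} → x ≢ u → x ≢ w → R⁺ u w → BuiltEdge b u w
    old-edge _   _   (inj₁ e)                 = e
    old-edge x≢u _   (inj₂ (inj₁ (refl , _))) = contradiction refl x≢u
    old-edge _   x≢w (inj₂ (inj₂ (_ , refl))) = contradiction refl x≢w

    module _ (_≟_ : DecidableEquality V) where

      -- Folding the leaf x onto its only neighbour y turns a walk of the larger tree into one of
      -- the old tree: steps at x become stationary and all others are old edges.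
      retract : V → V
      retract u with x ≟ u
      ... | yes _ = y
      ... | no  _ = u

      retract-fix : ∀ {u} → x ≢ u → retract u ≡ u
      retract-fix {u} x≢u with x ≟ u
      ... | yes x≡u = contradiction x≡u x≢u
      ... | no  _   = refl

      retract-step : ∀ {z u w} → (R⁺ ∖ (z ≡_)) u w → Star (BuiltEdge b ∖ (z ≡_)) (retract u) (retract w)
      retract-step {u = u} {w} (e , z≢u , z≢w) with x ≟ u | x ≟ w
      ... | yes refl | yes refl = ε
      ... | yes refl | no  _    rewrite leaf-nbr e = ε
      ... | no  _    | yes refl rewrite leaf-nbr (leaf-symmetric e) = ε
      ... | no  x≢u  | no  x≢w  = (old-edge x≢u x≢w e , z≢u , z≢w) ◅ ε

      -- A walk from the leaf x must pass through its only neighbour.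
      no-escape : ∀ {z c} → R⁺ z x → x ≢ c → ¬ Star (R⁺ ∖ (z ≡_)) x c
      no-escape zx x≢c ε = x≢c refl
      no-escape zx x≢c ((e , _ , z≢u) ◅ _) = z≢u (trans (leaf-nbr (leaf-symmetric zx)) (≡-sym (leaf-nbr e)))

      -- If z is the leaf, it has only one neighbour. If c or d is the leaf, then z is its only
      -- neighbour and a walk off z cannot leave it. Otherwise the walk is folded into the old tree.
      leaf-acyclic : Acyclic R⁺
      leaf-acyclic {z} {c} {d} zc zd c≢d s with x ≟ z | x ≟ c | x ≟ d
      ... | yes refl | _ | _ = c≢d (trans (leaf-nbr zc) (≡-sym (leaf-nbr zd)))
      ... | no _ | yes refl | _ = no-escape zc c≢d s
      ... | no _ | no _ | yes refl = no-escape zd (c≢d ∘ ≡-sym) (∖-reverse leaf-symmetric s)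
      ... | no x≢z | no x≢c | no x≢d =
        acyclic (old-edge x≢z x≢c zc) (old-edge x≢z x≢d zd) c≢d
          (subst₂ (Star (BuiltEdge b ∖ (z ≡_))) (retract-fix x≢c) (retract-fix x≢d)
            (Star.kleisliStar retract retract-step s))

      leaf-tree : IsTree (_∈ˡ (x ∷ L)) R⁺
      leaf-tree = record
        { source    = λ { (inj₁ e) → there (source e) ; (inj₂ (inj₁ (p , _))) → here p ; (inj₂ (inj₂ (refl , _))) → there y∈ }
        ; symmetric = leaf-symmetric
        ; irr       = λ { (inj₁ e) → irr e
                        ; (inj₂ (inj₁ (refl , refl))) → x∉ y∈
                        ; (inj₂ (inj₂ (refl , refl))) → x∉ y∈ }
        ; connected = λ { (here refl) (here refl) → ε
                        ; (here refl) (there q) → inj₂ (inj₁ (refl , refl)) ◅ Star.map inj₁ (connected y∈ q)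
                        ; (there p) (here refl) → Star.map inj₁ (connected p y∈) ◅◅ (inj₂ (inj₂ (refl , refl)) ◅ ε)
                        ; (there p) (there q) → Star.map inj₁ (connected p q) }
        ; acyclic   = leaf-acyclic
        }

  built-tree : DecidableEquality V → ∀ {L} (b : Built Adj L) → IsTree (_∈ˡ L) (BuiltEdge b)
  built-tree _≟_ (root r) = record
    { source = λ () ; symmetric = λ () ; irr = λ ()
    ; connected = λ { (here refl) (here refl) → ε } ; acyclic = λ () }
  built-tree _≟_ (leaf x y x∉ y∈ a b) = leaf-tree b x∉ y∈ a (built-tree _≟_ b) _≟_

built-map : {V W : Set} {A : V → V → Set} {B : W → W → Set} (f : V → W) →
            (∀ {x y} → f x ≡ f y → x ≡ y) → (∀ {x y} → A x y → B (f x) (f y)) →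
            ∀ {L} → Built A L → Built B (map f L)
built-map f inj mono (root r) = root (f r)
built-map {V} f inj mono {_ ∷ L} (leaf x y x∉ y∈ a b) =
  leaf (f x) (f y) fresh (Membership.∈-map⁺ f y∈) (mono a) (built-map f inj mono b)
  where
  fresh : f x ∉ˡ map f L
  fresh fx∈ with Membership.∈-map⁻ f fx∈
  ... | z , z∈ , eq = x∉ (subst (_∈ˡ L) (≡-sym (inj eq)) z∈)

-- Sums over all subsets

_≟ˢ_ : ∀ {n} → DecidableEquality (Subset n)
_≟ˢ_ = Vec.≡-dec Bool._≟_

allSubset? : ∀ {n} {P : Subset n → Set} → Decidable P → Dec (∀ p → P p)
allSubset? P? with anySubset? (¬? ∘ P?)
... | yes (p , ¬Pp) = no λ f → ¬Pp (f p)
... | no  ¬∃        = yes λ p → decidable-stable (P? p) λ ¬Pp → ¬∃ (p , ¬Pp)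

allSubsets-complete : ∀ {n} (p : Subset n) → p ∈ˡ allSubsets n
allSubsets-complete []          = here refl
allSubsets-complete (false ∷ p) = Membership.∈-++⁺ˡ (Membership.∈-map⁺ _ (allSubsets-complete p))
allSubsets-complete (true ∷ p)  = Membership.∈-++⁺ʳ _ (Membership.∈-map⁺ _ (allSubsets-complete p))

-- Recursion on n in place of a sum over a list lets the laws below follow by induction;
-- `sum-allSubsets` relates the two.
∑ : ∀ {n} → (Subset n → ℕ) → ℕ
∑ {zero}  f = f []
∑ {suc n} f = ∑ (f ∘ (outside ∷_)) + ∑ (f ∘ (inside ∷_))

∑-cong : ∀ {n} {f g : Subset n → ℕ} → (∀ p → f p ≡ g p) → ∑ f ≡ ∑ g
∑-cong {zero}  eq = eq []
∑-cong {suc n} eq = cong₂ _+_ (∑-cong (eq ∘ (outside ∷_))) (∑-cong (eq ∘ (inside ∷_)))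

∑-zero : ∀ {n} {f : Subset n → ℕ} → (∀ p → f p ≡ 0) → ∑ f ≡ 0
∑-zero {zero}  eq = eq []
∑-zero {suc n} eq = cong₂ _+_ (∑-zero (eq ∘ (outside ∷_))) (∑-zero (eq ∘ (inside ∷_)))

∑-+ : ∀ {n} (f g : Subset n → ℕ) → ∑ (λ p → f p + g p) ≡ ∑ f + ∑ g
∑-+ {zero}  f g = refl
∑-+ {suc n} f g = trans (cong₂ _+_ (∑-+ (f ∘ (outside ∷_)) (g ∘ (outside ∷_))) (∑-+ (f ∘ (inside ∷_)) (g ∘ (inside ∷_))))
                        (+-interchange (∑ (f ∘ (outside ∷_))) (∑ (g ∘ (outside ∷_))) (∑ (f ∘ (inside ∷_))) (∑ (g ∘ (inside ∷_))))

∑-* : ∀ {n} k (f : Subset n → ℕ) → ∑ (λ p → k * f p) ≡ k * ∑ f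
∑-* {zero}  k f = refl
∑-* {suc n} k f = trans (cong₂ _+_ (∑-* k (f ∘ (outside ∷_))) (∑-* k (f ∘ (inside ∷_))))
                        (≡-sym (ℕ.*-distribˡ-+ k (∑ (f ∘ (outside ∷_))) (∑ (f ∘ (inside ∷_)))))

∑-swap : ∀ {m n} (f : Subset m → Subset n → ℕ) → ∑ (λ p → ∑ (f p)) ≡ ∑ (λ q → ∑ λ p → f p q)
∑-swap {zero}  f = refl
∑-swap {suc m} f = trans (cong₂ _+_ (∑-swap (f ∘ (outside ∷_))) (∑-swap (f ∘ (inside ∷_))))
                         (≡-sym (∑-+ (λ q → ∑ λ p → f (outside ∷ p) q) (λ q → ∑ λ p → f (inside ∷ p) q)))

∑-mono-≤ : ∀ {n} {f g : Subset n → ℕ} → (∀ p → f p ≤ g p) → ∑ f ≤ ∑ g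
∑-mono-≤ {zero}  le = le []
∑-mono-≤ {suc n} le = ℕ.+-mono-≤ (∑-mono-≤ (le ∘ (outside ∷_))) (∑-mono-≤ (le ∘ (inside ∷_)))

∑-mono-< : ∀ {n} {f g : Subset n → ℕ} → (∀ p → f p ≤ g p) → ∀ p → f p < g p → ∑ f < ∑ g
∑-mono-< le []          lt = lt
∑-mono-< le (false ∷ p) lt = ℕ.+-mono-<-≤ (∑-mono-< (le ∘ (outside ∷_)) p lt) (∑-mono-≤ (le ∘ (inside ∷_)))
∑-mono-< le (true ∷ p)  lt = ℕ.+-mono-≤-< (∑-mono-≤ (le ∘ (outside ∷_))) (∑-mono-< (le ∘ (inside ∷_)) p lt)

∑-single : ∀ {n} {f : Subset n → ℕ} p → f p ≡ 1 → (∀ q → q ≢ p → f q ≡ 0) → ∑ f ≡ 1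
∑-single []          one none = one
∑-single (false ∷ p) one none =
  cong₂ _+_ (∑-single p one λ q q≢p → none _ λ { refl → q≢p refl }) (∑-zero λ q → none (inside ∷ q) λ ())
∑-single (true ∷ p)  one none =
  cong₂ _+_ (∑-zero λ q → none (outside ∷ q) λ ()) (∑-single p one λ q q≢p → none _ λ { refl → q≢p refl })

sum-allSubsets : ∀ {n} (f : Subset n → ℕ) → sum (map f (allSubsets n)) ≡ ∑ f
sum-allSubsets {zero}  f = ℕ.+-identityʳ (f [])
sum-allSubsets {suc n} f = begin
  sum (map f (map (outside ∷_) A ++ map (inside ∷_) A))
    ≡⟨ cong sum (List.map-++ f (map (outside ∷_) A) _) ⟩
  sum (map f (map (outside ∷_) A) ++ map f (map (inside ∷_) A))
    ≡⟨ sum-++ (map f (map (outside ∷_) A)) _ ⟩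
  sum (map f (map (outside ∷_) A)) + sum (map f (map (inside ∷_) A))
    ≡⟨ cong₂ (λ xs ys → sum xs + sum ys) (List.map-∘ A) (List.map-∘ A) ⟨
  sum (map (f ∘ (outside ∷_)) A) + sum (map (f ∘ (inside ∷_)) A)
    ≡⟨ cong₂ _+_ (sum-allSubsets (f ∘ (outside ∷_))) (sum-allSubsets (f ∘ (inside ∷_))) ⟩
  ∑ f ∎
  where
  open ≡-Reasoning
  A = allSubsets n

sum-cartesianProductWith : ∀ {A B : Set} (f : A → B → ℕ) xs ys →
  sum (cartesianProductWith f xs ys) ≡ sum (map (λ x → sum (map (f x) ys)) xs)
sum-cartesianProductWith f []       ys = refl
sum-cartesianProductWith f (x ∷ xs) ys =
  trans (sum-++ (map (f x) ys) _) (cong (sum (map (f x) ys) +_) (sum-cartesianProductWith f xs ys))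

sum-pairs : ∀ {n} (f : Subset n → Subset n → ℕ) →
            sum (cartesianProductWith f (allSubsets n) (allSubsets n)) ≡ ∑ λ p → ∑ (f p)
sum-pairs {n} f = trans (sum-cartesianProductWith f (allSubsets n) (allSubsets n))
                 (trans (sum-allSubsets λ p → sum (map (f p) (allSubsets n))) (∑-cong (sum-allSubsets ∘ f)))

-- The number of edges of a tree

-- The Iverson bracket.
⟦_⟧ : {A : Set} → Dec A → ℕ
⟦ d ⟧ = if does d then 1 else 0

⟦⟧-yes : {A : Set} (d : Dec A) → A → ⟦ d ⟧ ≡ 1
⟦⟧-yes d a rewrite dec-true d a = refl

⟦⟧-no : {A : Set} (d : Dec A) → ¬ A → ⟦ d ⟧ ≡ 0
⟦⟧-no d ¬a rewrite dec-false d ¬a = refl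

-- For symmetric T every edge is counted twice, once per ordering, to match `weight2`.
edgeCount : ∀ {n} → EdgeSet n → ℕ
edgeCount T = ∑ λ p → ∑ λ q → if T p q then 1 else 0

starˢ? : ∀ {n} {R : Subset n → Subset n → Set} → Binary.Decidable R → Binary.Decidable (Star R)
starˢ? R? = star? _≟ˢ_ R? allSubsets-complete

_∖?_ : ∀ {V : Set} {R : V → V → Set} {P : V → Set} → Binary.Decidable R → Decidable P → Binary.Decidable (R ∖ P)
(R? ∖? P?) x y = R? x y ×-dec ¬? (P? x) ×-dec ¬? (P? y)

tedge? : ∀ {n} (T : EdgeSet n) → Binary.Decidable (TEdge T)
tedge? T p q = T p q Bool.≟ true

∖-end : ∀ {V : Set} {R : V → V → Set} {x y} → x ≢ y → ¬ Star (R ∖ (x ≡_)) y x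
∖-end x≢y ε                    = x≢y refl
∖-end x≢y ((_ , _ , x≢z) ◅ s) = ∖-end x≢z s

-- Rooting the tree at r, every edge joins a vertex to its parent in exactly
-- one direction and every vertex but r has exactly one parent.
module _ {n} {Vtx : Subset n → Set} (Vtx? : Decidable Vtx) {r} (Vr : Vtx r)
         {T : EdgeSet n} (t : IsTree Vtx (TEdge T)) where
  open IsTree t

  private
    E = TEdge T

  Parent : Subset n → Subset n → Set
  Parent u v = E u v × Star (E ∖ (u ≡_)) v r

  parent? : Binary.Decidable Parent
  parent? u v = tedge? T u v ×-dec starˢ? (tedge? T ∖? (u ≟ˢ_)) v r

  -- Two different parents of u would be joined through r off u, against `acyclic`.
  parent-unique : ∀ {u v w} → Parent u v → Parent u w → v ≡ w
  parent-unique {v = v} {w} (uv , p) (uw , q) with v ≟ˢ w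
  ... | yes v≡w = v≡w
  ... | no  v≢w = ⊥-elim (acyclic uv uw v≢w (p ◅◅ ∖-reverse symmetric q))

  parent-exists : ∀ {u} → Vtx u → u ≢ r → ∃ (Parent u)
  parent-exists {u} Vu u≢r with lastExit _≟ˢ_ u u≢r (connected Vu Vr)
  ... | inj₁ (u≢u , _)          = contradiction refl u≢u
  ... | inj₂ (v , uv , _ , s) = v , uv , s

  -- Take the walk from the parent y of v to r. If it misses u, prefixing v shows that v is the
  -- parent of u. If it visits u, its part after the last visit misses v, so u is the parent of v.
  parent-total : ∀ {u v} → E u v → Parent u v ⊎ Parent v u
  parent-total {u} {v} uv with u ≟ˢ r | v ≟ˢ r
  ... | yes refl | _        = inj₂ (symmetric uv , ε)
  ... | no _     | yes refl = inj₁ (uv , ε)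
  ... | no u≢r   | no v≢r with parent-exists (source (symmetric uv)) v≢r
  ...   | y , vy , s with lastExit _≟ˢ_ u u≢r s
  ...     | inj₁ (u≢y , p) = inj₁ (uv , (vy , (λ { refl → irr uv }) , u≢y) ◅ Star.map (λ { ((e , _) , a) → e , a }) p)
  ...     | inj₂ (_ , uz , _ , p) = inj₂ (symmetric uv , uz ◅ forget p)

  -- The walk from v to r off u, cut after its last visit to v, would give v a parent different from
  -- u.
  parent-asym : ∀ {u v} → Parent u v → ¬ Parent v u
  parent-asym {u} {v} (uv , p) (vu , q) with v ≟ˢ r
  ... | yes refl = ∖-end (λ { refl → irr uv }) q
  ... | no  v≢r with lastExit _≟ˢ_ v v≢r p
  ...   | inj₁ (v≢v , _) = v≢v refl
  ...   | inj₂ (y , (vy , _ , u≢y) , _ , s) =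
            u≢y (parent-unique (vu , q) (vy , Star.map (λ { ((e , _) , a) → e , a }) s))

  edge-orientation : ∀ u v → (if T u v then 1 else 0) ≡ ⟦ parent? u v ⟧ + ⟦ parent? v u ⟧
  edge-orientation u v = orient (T u v) refl
    where
    orient : ∀ b → T u v ≡ b → (if b then 1 else 0) ≡ ⟦ parent? u v ⟧ + ⟦ parent? v u ⟧
    orient false eq = ≡-sym (cong₂ _+_
      (⟦⟧-no (parent? u v) λ { (e , _) → contradiction (trans (≡-sym eq) e) λ () })
      (⟦⟧-no (parent? v u) λ { (e , _) → contradiction (trans (≡-sym eq) (symmetric e)) λ () }))
    orient true eq with parent-total eq
    ... | inj₁ p = ≡-sym (cong₂ _+_ (⟦⟧-yes (parent? u v) p) (⟦⟧-no (parent? v u) (parent-asym p)))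
    ... | inj₂ p = ≡-sym (cong₂ _+_ (⟦⟧-no (parent? u v) (λ q → parent-asym q p)) (⟦⟧-yes (parent? v u) p))

  nonRoot? : ∀ u → Dec (Vtx u × u ≢ r)
  nonRoot? u = Vtx? u ×-dec ¬? (u ≟ˢ r)

  parent-count : ∀ u → ∑ (λ v → ⟦ parent? u v ⟧) ≡ ⟦ nonRoot? u ⟧
  parent-count u with nonRoot? u
  ... | yes nr@(Vu , u≢r) = let (v , p) = parent-exists Vu u≢r in
        trans (∑-single v (⟦⟧-yes (parent? u v) p) λ w w≢v → ⟦⟧-no (parent? u w) λ q → w≢v (parent-unique q p)) (≡-sym (⟦⟧-yes (nonRoot? u) nr))
  ... | no  ¬nr = trans (∑-zero λ v → ⟦⟧-no (parent? u v) λ { (uv , s) →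
        ¬nr (source uv , λ { refl → ∖-end (λ { refl → irr uv }) s }) })
        (≡-sym (⟦⟧-no (nonRoot? u) ¬nr))

  -- The right side does not mention T, which makes any two trees on the same vertices comparable.
  -- The two summands are the two orientations of each edge, equal after exchanging the sums.
  edgeCount-tree : edgeCount T ≡ ∑ (⟦_⟧ ∘ nonRoot?) + ∑ (⟦_⟧ ∘ nonRoot?)
  edgeCount-tree = begin
    edgeCount T
      ≡⟨ ∑-cong (λ u → trans (∑-cong (edge-orientation u)) (∑-+ (λ v → ⟦ parent? u v ⟧) (λ v → ⟦ parent? v u ⟧))) ⟩
    ∑ (λ u → ∑ (λ v → ⟦ parent? u v ⟧) + ∑ (λ v → ⟦ parent? v u ⟧))
      ≡⟨ ∑-+ (λ u → ∑ (λ v → ⟦ parent? u v ⟧)) (λ u → ∑ (λ v → ⟦ parent? v u ⟧)) ⟩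
    ∑ (λ u → ∑ (λ v → ⟦ parent? u v ⟧)) + ∑ (λ u → ∑ (λ v → ⟦ parent? v u ⟧))
      ≡⟨ cong (∑ (λ u → ∑ (λ v → ⟦ parent? u v ⟧)) +_) (∑-swap (λ u v → ⟦ parent? u v ⟧)) ⟨
    ∑ (λ u → ∑ (λ v → ⟦ parent? u v ⟧)) + ∑ (λ u → ∑ (λ v → ⟦ parent? u v ⟧))
      ≡⟨ cong (λ m → m + m) (∑-cong parent-count) ⟩
    ∑ (⟦_⟧ ∘ nonRoot?) + ∑ (⟦_⟧ ∘ nonRoot?) ∎
    where open ≡-Reasoning

edgeCount-unique : ∀ {n} {Vtx : Subset n → Set} → Decidable Vtx → ∃ Vtx → ∀ {T T′} →
                   IsTree Vtx (TEdge T) → IsTree Vtx (TEdge T′) → edgeCount T ≡ edgeCount T′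
edgeCount-unique Vtx? (_ , Vr) {T} {T′} t t′ =
  trans (edgeCount-tree Vtx? Vr {T} t) (≡-sym (edgeCount-tree Vtx? Vr {T′} t′))

-- Weight compared with edge count

weight2-∑ : ∀ {n} (T : EdgeSet n) → weight2 T ≡ ∑ λ p → ∑ λ q → if T p q then ∣ p ∩ q ∣ else 0
weight2-∑ T = sum-pairs λ p q → if T p q then ∣ p ∩ q ∣ else 0

module _ {n} (k : ℕ) (T : EdgeSet n) where

  private
    kEdges : Subset n → Subset n → ℕ
    kEdges p q = k * (if T p q then 1 else 0)

    ∑-kEdges : (∑ λ p → ∑ (kEdges p)) ≡ k * edgeCount T
    ∑-kEdges = trans (∑-cong λ p → ∑-* k (λ q → if T p q then 1 else 0)) (∑-* k λ p → ∑ λ q → if T p q then 1 else 0)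

  weight2-const : (∀ p q → TEdge T p q → ∣ p ∩ q ∣ ≡ k) → weight2 T ≡ k * edgeCount T
  weight2-const eqk = trans (weight2-∑ T) (trans (∑-cong (λ p → ∑-cong (pointwise p))) ∑-kEdges)
    where
    pointwise : ∀ p q → (if T p q then ∣ p ∩ q ∣ else 0) ≡ kEdges p q
    pointwise p q with T p q in eq
    ... | true  = trans (eqk p q eq) (≡-sym (ℕ.*-identityʳ k))
    ... | false = ≡-sym (ℕ.*-zeroʳ k)

  module _ (le : ∀ p q → TEdge T p q → ∣ p ∩ q ∣ ≤ k) where

    private
      pointwise : ∀ p q → (if T p q then ∣ p ∩ q ∣ else 0) ≤ kEdges p q
      pointwise p q with T p q in eq
      ... | true  = ℕ.≤-trans (le p q eq) (ℕ.≤-reflexive (≡-sym (ℕ.*-identityʳ k)))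
      ... | false = z≤n

    weight2-≤ : weight2 T ≤ k * edgeCount T
    weight2-≤ = subst₂ _≤_ (≡-sym (weight2-∑ T)) ∑-kEdges (∑-mono-≤ λ p → ∑-mono-≤ (pointwise p))

    weight2-< : ∀ p q → TEdge T p q → ∣ p ∩ q ∣ < k → weight2 T < k * edgeCount T
    weight2-< p q e lt = subst₂ _<_ (≡-sym (weight2-∑ T)) ∑-kEdges
      (∑-mono-< (λ p → ∑-mono-≤ (pointwise p)) p (∑-mono-< (pointwise p) q strict))
      where
      strict : (if T p q then ∣ p ∩ q ∣ else 0) < kEdges p q
      strict rewrite e = ℕ.<-≤-trans lt (ℕ.≤-reflexive (≡-sym (ℕ.*-identityʳ k)))

-- Subsets of a set with one more point

p⊆q∧∣q∣≤∣p∣⇒q⊆p : ∀ {n} {p q : Subset n} → p ⊆ q → ∣ q ∣ ≤ ∣ p ∣ → q ⊆ p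
p⊆q∧∣q∣≤∣p∣⇒q⊆p {p = p} p⊆q le {x} x∈q with x ∈? p
... | yes x∈p = x∈p
... | no  x∉p = contradiction le (ℕ.<⇒≱ (p⊂q⇒∣p∣<∣q∣ (p⊆q , x , x∈q , x∉p)))

p⊆q∧∣p∣≡∣q∣⇒p≡q : ∀ {n} {p q : Subset n} → p ⊆ q → ∣ p ∣ ≡ ∣ q ∣ → p ≡ q
p⊆q∧∣p∣≡∣q∣⇒p≡q p⊆q eq = ⊆-antisym p⊆q (p⊆q∧∣q∣≤∣p∣⇒q⊆p p⊆q (ℕ.≤-reflexive (≡-sym eq)))

∣p∣<∣q∣⇒∃∈q∉p : ∀ {n} (p q : Subset n) → ∣ p ∣ < ∣ q ∣ → ∃ λ x → x ∈ q × x ∉ p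
∣p∣<∣q∣⇒∃∈q∉p p q lt with Fin.any? (λ x → x ∈? q ×-dec ¬? (x ∈? p))
... | yes found = found
... | no  none  = contradiction (p⊆q⇒∣p∣≤∣q∣ q⊆p) (ℕ.<⇒≱ lt)
  where
  q⊆p : q ⊆ p
  q⊆p {x} x∈q = decidable-stable (x ∈? p) λ x∉p → none (x , x∈q , x∉p)

two-more : ∀ {n} {p q : Subset n} {a b} → p ⊆ q → a ∈ q → b ∈ q → a ∉ p → b ∉ p → a ≢ b → 2 + ∣ p ∣ ≤ ∣ q ∣
two-more {p = p} {q} {a} {b} p⊆q a∈q b∈q a∉p b∉p a≢b =
  ℕ.≤-trans (s≤s (p⊂q⇒∣p∣<∣q∣ (p⊆p∪q ⁅ a ⁆ , a , q⊆p∪q p ⁅ a ⁆ (x∈⁅x⁆ a) , a∉p)))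
            (p⊂q⇒∣p∣<∣q∣ (pa⊆q , b , b∈q , b∉pa))
  where
  pa⊆q : p ∪ ⁅ a ⁆ ⊆ q
  pa⊆q x∈ with x∈p∪q⁻ p ⁅ a ⁆ x∈
  ... | inj₁ x∈p = p⊆q x∈p
  ... | inj₂ x∈a rewrite x∈⁅y⁆⇒x≡y a x∈a = a∈q
  b∉pa : b ∉ p ∪ ⁅ a ⁆
  b∉pa b∈ with x∈p∪q⁻ p ⁅ a ⁆ b∈
  ... | inj₁ b∈p = b∉p b∈p
  ... | inj₂ b∈a = a≢b (≡-sym (x∈⁅y⁆⇒x≡y a b∈a))

module _ {n} (v : Fin (suc n)) where

  punched : ∀ x → x ≡ v ⊎ ∃ λ i → x ≡ punchIn v i
  punched x with v Fin.≟ x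
  ... | yes v≡x = inj₁ (≡-sym v≡x)
  ... | no  v≢x = inj₂ (punchOut v≢x , ≡-sym (Fin.punchIn-punchOut v≢x))

  -- This is how inductions on k-trees ask whether a clique contains the last vertex v.
  insert-split : (Q : Subset (suc n)) → ∃ λ Q′ → Q ≡ insertAt Q′ v inside ⊎ Q ≡ insertAt Q′ v outside
  insert-split Q with lookup Q v | ≡-sym (Vec.insertAt-removeAt Q v)
  ... | true  | eq = removeAt Q v , inj₁ eq
  ... | false | eq = removeAt Q v , inj₂ eq

  insertAt-injective : ∀ {b} {p q : Subset n} → insertAt p v b ≡ insertAt q v b → p ≡ q
  insertAt-injective {b} {p} {q} eq =
    trans (≡-sym (Vec.removeAt-insertAt p v b)) (trans (cong (λ s → removeAt s v) eq) (Vec.removeAt-insertAt q v b))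

  ∈-insertAt⁺ : ∀ {b i} {p : Subset n} → i ∈ p → punchIn v i ∈ insertAt p v b
  ∈-insertAt⁺ {b} {i} {p} i∈ = Vec.lookup⇒[]= _ _ (trans (Vec.insertAt-punchIn p v b i) (Vec.[]=⇒lookup i∈))

  ∈-insertAt⁻ : ∀ {b i} {p : Subset n} → punchIn v i ∈ insertAt p v b → i ∈ p
  ∈-insertAt⁻ {b} {i} {p} i∈ = Vec.lookup⇒[]= _ _ (trans (≡-sym (Vec.insertAt-punchIn p v b i)) (Vec.[]=⇒lookup i∈))

  ∈-insertAt-inside : ∀ (p : Subset n) → v ∈ insertAt p v inside
  ∈-insertAt-inside p = Vec.lookup⇒[]= _ _ (Vec.insertAt-lookup p v inside)

  ∉-insertAt-outside : ∀ (p : Subset n) → v ∉ insertAt p v outside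
  ∉-insertAt-outside p v∈ with trans (≡-sym (Vec.insertAt-lookup p v outside)) (Vec.[]=⇒lookup v∈)
  ... | ()

  insertAt-⊆⁺ : ∀ {b} {p q : Subset n} → p ⊆ q → insertAt p v b ⊆ insertAt q v b
  insertAt-⊆⁺ {b} {p} {q} p⊆q {x} x∈ with punched x
  ... | inj₂ (i , refl) = ∈-insertAt⁺ (p⊆q (∈-insertAt⁻ x∈))
  ... | inj₁ refl with b
  ...   | true  = ∈-insertAt-inside q
  ...   | false = contradiction x∈ (∉-insertAt-outside p)

∣insertAt-inside∣ : ∀ {n} (p : Subset n) v → ∣ insertAt p v inside ∣ ≡ suc ∣ p ∣
∣insertAt-inside∣ p           zero    = refl
∣insertAt-inside∣ (true ∷ p)  (suc v) = cong suc (∣insertAt-inside∣ p v)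
∣insertAt-inside∣ (false ∷ p) (suc v) = ∣insertAt-inside∣ p v

∣insertAt-outside∣ : ∀ {n} (p : Subset n) v → ∣ insertAt p v outside ∣ ≡ ∣ p ∣
∣insertAt-outside∣ p           zero    = refl
∣insertAt-outside∣ (true ∷ p)  (suc v) = cong suc (∣insertAt-outside∣ p v)
∣insertAt-outside∣ (false ∷ p) (suc v) = ∣insertAt-outside∣ p v

insertAt-∩ : ∀ {n} (p q : Subset n) v a b → insertAt p v a ∩ insertAt q v b ≡ insertAt (p ∩ q) v (a ∧ b)
insertAt-∩ p       q       zero    a b = refl
insertAt-∩ (x ∷ p) (y ∷ q) (suc v) a b = cong (_ ∷_) (insertAt-∩ p q v a b)

-- Cliques of k-trees

module _ {n} (G : Graph n) where

  edge-sym : ∀ {i j} → Edge G i j → Edge G j i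
  edge-sym {i} {j} e = trans (sym G j i) e

  edge-irr : ∀ {i} → ¬ Edge G i i
  edge-irr {i} e with trans (≡-sym (irrefl G i)) e
  ... | ()

module _ {n} (G : Graph (suc n)) (v : Fin (suc n)) {Q : Subset n} where

  clique-delete : ∀ {b} → IsClique G (insertAt Q v b) → IsClique (delete v G) Q
  clique-delete c i j i∈ j∈ i≢j =
    c _ _ (∈-insertAt⁺ v i∈) (∈-insertAt⁺ v j∈) (i≢j ∘ Fin.punchIn-injective v i j)

  clique-inside⁻ : IsClique G (insertAt Q v inside) → ∀ {i} → i ∈ Q → Edge G v (punchIn v i)
  clique-inside⁻ c i∈ = c _ _ (∈-insertAt-inside v Q) (∈-insertAt⁺ v i∈) (Fin.punchInᵢ≢i v _ ∘ ≡-sym)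

  clique-outside⁺ : IsClique (delete v G) Q → IsClique G (insertAt Q v outside)
  clique-outside⁺ c x y x∈ y∈ x≢y with punched v x | punched v y
  ... | inj₁ refl | _ = contradiction x∈ (∉-insertAt-outside v Q)
  ... | inj₂ _    | inj₁ refl = contradiction y∈ (∉-insertAt-outside v Q)
  ... | inj₂ (i , refl) | inj₂ (j , refl) =
    c i j (∈-insertAt⁻ v x∈) (∈-insertAt⁻ v y∈) (x≢y ∘ cong (punchIn v))

  clique-inside⁺ : IsClique (delete v G) Q → (∀ {i} → i ∈ Q → Edge G v (punchIn v i)) →
                   IsClique G (insertAt Q v inside)
  clique-inside⁺ c nbr x y x∈ y∈ x≢y with punched v x | punched v y
  ... | inj₁ refl | inj₁ refl = contradiction refl x≢y
  ... | inj₁ refl | inj₂ (j , refl) = nbr (∈-insertAt⁻ v y∈)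
  ... | inj₂ (i , refl) | inj₁ refl = edge-sym G (nbr (∈-insertAt⁻ v x∈))
  ... | inj₂ (i , refl) | inj₂ (j , refl) =
    c i j (∈-insertAt⁻ v x∈) (∈-insertAt⁻ v y∈) (x≢y ∘ cong (punchIn v))

-- The maximal cliques of a k-tree described by size, which is k + 1. For sets avoiding v the
-- condition is the same in G and in `delete v G`.
KClique : ∀ {n} → ℕ → Graph n → Subset n → Set
KClique k G Q = IsClique G Q × ∣ Q ∣ ≡ suc k

-- A clique through the last vertex v consists of v and some of its k neighbours.
clique-size : ∀ {k n} {G : Graph n} → IsKTree k G → ∀ {Q} → IsClique G Q → ∣ Q ∣ ≤ suc k
clique-size (base G _) {Q} c = ∣p∣≤n Q
clique-size (step G v N kt _ refl nbr) {Q} c with insert-split v Q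
... | Q′ , inj₁ refl rewrite ∣insertAt-inside∣ Q′ v =
  s≤s (p⊆q⇒∣p∣≤∣q∣ λ i∈ → proj₁ (nbr _) (clique-inside⁻ G v c i∈))
... | Q′ , inj₂ refl rewrite ∣insertAt-outside∣ Q′ v = clique-size kt (clique-delete G v c)

-- A clique through v is completed by all of N; one avoiding v is already completed in the smaller
-- k-tree.
clique-extends : ∀ {k n} {G : Graph n} → IsKTree k G → ∀ {Q} → IsClique G Q →
                 ∃ λ K → KClique k G K × Q ⊆ K
clique-extends (base G complete) c = ⊤ , ((λ i j _ _ → complete i j) , ∣⊤∣≡n _) , ⊆⊤
clique-extends (step G v N kt cN refl nbr) {Q} c with insert-split v Q
... | Q′ , inj₁ refl = insertAt N v inside ,
      (clique-inside⁺ G v cN (λ i∈ → proj₂ (nbr _) i∈) , ∣insertAt-inside∣ N v) ,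
      insertAt-⊆⁺ v λ i∈ → proj₁ (nbr _) (clique-inside⁻ G v c i∈)
... | Q′ , inj₂ refl with clique-extends kt (clique-delete G v c)
...   | K , (cK , size) , Q′⊆K = insertAt K v outside ,
      (clique-outside⁺ G v cK , trans (∣insertAt-outside∣ K v) size) , insertAt-⊆⁺ v Q′⊆K

module _ {k n} {G : Graph n} (kt : IsKTree k G) where

  kClique⇒maxClique : ∀ {Q} → KClique k G Q → IsMaxClique G Q
  kClique⇒maxClique (c , size) = c , λ S cS Q⊆S →
    ⊆-antisym (p⊆q∧∣q∣≤∣p∣⇒q⊆p Q⊆S (subst (∣ S ∣ ≤_) (≡-sym size) (clique-size kt cS))) Q⊆S

  maxClique⇒kClique : ∀ {Q} → IsMaxClique G Q → KClique k G Q
  maxClique⇒kClique (c , maximal) with clique-extends kt c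
  ... | K , kK , Q⊆K = subst (KClique k G) (maximal K (proj₁ kK) Q⊆K) kK

-- Two (k+1)-cliques sharing exactly k vertices are separated by these: when
-- the last vertex v is removed, walks through v are rerouted inside the clique
-- of its neighbours.
separates : ∀ {k n} {G : Graph n} → IsKTree k G → ∀ {S a b} → ∣ S ∣ ≡ k → IsClique G S →
            a ∉ S → b ∉ S → a ≢ b → (∀ {s} → s ∈ S → Edge G s a) → (∀ {s} → s ∈ S → Edge G s b) →
            ¬ Star (Edge G ∖ (_∈ S)) a b
separates (base G _) ∣S∣≡k c a∉ b∉ a≢b Sa Sb s =
  -- S, a and b would make k + 2 vertices out of k + 1.
  contradiction (subst₂ _≤_ (cong (2 +_) ∣S∣≡k) (∣⊤∣≡n _) (two-more ⊆⊤ ∈⊤ ∈⊤ a∉ b∉ a≢b)) (ℕ.<⇒≱ ℕ.≤-refl)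
separates {k} (step {n} G v N kt cN ∣N∣≡k nbr) {S} {a} {b} ∣S∣≡k c a∉ b∉ a≢b Sa Sb s with insert-split v S
-- If v is in S, then a, b and the rest of S are neighbours of v, so N with v, of size k + 1, would
-- contain k + 2 vertices.
... | S′ , inj₁ refl = contradiction
        (subst₂ _≤_ (cong (2 +_) ∣S∣≡k) (trans (∣insertAt-inside∣ N v) (cong suc ∣N∣≡k))
          (two-more S⊆N (nbr-∈ (Sa v∈S)) (nbr-∈ (Sb v∈S)) a∉ b∉ a≢b))
        (ℕ.<⇒≱ ℕ.≤-refl)
  where
  v∈S = ∈-insertAt-inside v S′
  nbr-∈ : ∀ {x} → Edge G v x → x ∈ insertAt N v inside
  nbr-∈ {x} e with punched v x
  ... | inj₁ refl       = ∈-insertAt-inside v N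
  ... | inj₂ (i , refl) = ∈-insertAt⁺ v (proj₁ (nbr i) e)
  S⊆N : insertAt S′ v inside ⊆ insertAt N v inside
  S⊆N = insertAt-⊆⁺ v λ i∈ → proj₁ (nbr _) (clique-inside⁻ G v c i∈)
... | S′ , inj₂ refl = cases (punched v a) (punched v b)
  where
  nbr-∈ : ∀ {x} → Edge G v x → x ∈ insertAt N v outside
  nbr-∈ {x} e with punched v x
  ... | inj₁ refl       = contradiction e (edge-irr G)
  ... | inj₂ (i , refl) = ∈-insertAt⁺ v (proj₁ (nbr i) e)

  -- If the walk starts at v, then S consists of neighbours of v and has as many elements as N. So S
  -- is the whole neighbourhood and the first step already enters it.
  endpoint : ∀ {d} → v ≢ d → (∀ {s} → s ∈ insertAt S′ v outside → Edge G s v) →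
             ¬ Star (Edge G ∖ (_∈ insertAt S′ v outside)) v d
  endpoint v≢d Sv ε                    = v≢d refl
  endpoint v≢d Sv ((e , _ , u∉) ◅ _) = u∉
    (p⊆q∧∣q∣≤∣p∣⇒q⊆p (λ s∈ → nbr-∈ (edge-sym G (Sv s∈)))
      (ℕ.≤-reflexive (trans (trans (∣insertAt-outside∣ N v) ∣N∣≡k) (≡-sym ∣S∣≡k))) (nbr-∈ e))

  reroute : ∀ {x y i j} → x ≡ punchIn v i → y ≡ punchIn v j →
            Star (Edge G ∖ (_∈ insertAt S′ v outside)) x y → Star (Edge (delete v G) ∖ (_∈ S′)) i j
  reroute {i = i} refl eq ε rewrite Fin.punchIn-injective v i _ eq = ε
  reroute refl eq (_◅_ {j = y} (e , x∉ , y∉) s) with punched v y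
  ... | inj₂ (_ , refl) = (e , x∉ ∘ ∈-insertAt⁺ v , y∉ ∘ ∈-insertAt⁺ v) ◅ reroute refl eq s
  -- The walk ends off v, so a step into v always has a successor. The vertices before and after v
  -- lie in N, hence are equal or adjacent.
  reroute refl eq (_ ◅ ε) | inj₁ refl = contradiction (≡-sym eq) (Fin.punchInᵢ≢i v _)
  reroute {i = i} refl eq ((e , x∉ , _) ◅ (_◅_ {j = z} (e′ , _ , z∉) s)) | inj₁ refl with punched v z
  ... | inj₁ refl = contradiction e′ (edge-irr G)
  ... | inj₂ (j , refl) with i Fin.≟ j
  ...   | yes refl = reroute refl eq s
  ...   | no  i≢j  = (cN i j (proj₁ (nbr i) (edge-sym G e)) (proj₁ (nbr j) e′) i≢j , x∉ ∘ ∈-insertAt⁺ v , z∉ ∘ ∈-insertAt⁺ v)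
                     ◅ reroute refl eq s

  cases : (a ≡ v ⊎ ∃ λ i → a ≡ punchIn v i) → (b ≡ v ⊎ ∃ λ i → b ≡ punchIn v i) → ⊥
  cases (inj₁ refl) _           = endpoint a≢b Sa s
  cases (inj₂ _)    (inj₁ refl) = endpoint (a≢b ∘ ≡-sym) Sb (∖-reverse (edge-sym G) s)
  cases (inj₂ (i , refl)) (inj₂ (j , refl)) =
    separates kt (trans (≡-sym (∣insertAt-outside∣ S′ v)) ∣S∣≡k) (clique-delete G v c)
      (a∉ ∘ ∈-insertAt⁺ v) (b∉ ∘ ∈-insertAt⁺ v) (a≢b ∘ cong (punchIn v))
      (Sa ∘ ∈-insertAt⁺ v) (Sb ∘ ∈-insertAt⁺ v) (reroute refl refl s)

-- A tree on the (k+1)-cliques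

Shares : ∀ {n} → ℕ → Subset n → Subset n → Set
Shares k Q Q′ = ∣ Q ∩ Q′ ∣ ≡ k

-- The only new (k+1)-clique is v with N. It becomes a leaf attached to any old (k+1)-clique K
-- containing N, and meets K exactly in N.
kCliques-built : ∀ {k n} {G : Graph n} → IsKTree k G →
  ∃ λ L → Built (Shares k) L × (∀ {Q} → KClique k G Q → Q ∈ˡ L) × (∀ {Q} → Q ∈ˡ L → KClique k G Q)
kCliques-built (base G complete) = [ ⊤ ] , root ⊤ , (λ { (_ , size) → here (∣p∣≡n⇒p≡⊤ size) }) ,
  λ { (here refl) → (λ i j _ _ → complete i j) , ∣⊤∣≡n _ }
kCliques-built {k} (step G v N kt cN ∣N∣≡k nbr)
  with kCliques-built kt | clique-extends kt cN
... | L , b , listed , sound | K , kK , N⊆K =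
  X ∷ map lift L , leaf X (lift K) fresh (Membership.∈-map⁺ lift (listed kK)) shares
    (built-map lift (insertAt-injective v) lift-shares b) , listed⁺ , sound⁺
  where
  X    = insertAt N v inside
  lift = λ Q → insertAt Q v outside

  fresh : X ∉ˡ map lift L
  fresh X∈ with Membership.∈-map⁻ lift X∈
  ... | Q , _ , eq = ∉-insertAt-outside v Q (subst (v ∈_) eq (∈-insertAt-inside v N))

  shares : Shares k X (lift K)
  shares = begin
    ∣ X ∩ lift K ∣                      ≡⟨ cong ∣_∣ (insertAt-∩ N K v inside outside) ⟩
    ∣ insertAt (N ∩ K) v outside ∣      ≡⟨ ∣insertAt-outside∣ (N ∩ K) v ⟩
    ∣ N ∩ K ∣                           ≡⟨ cong ∣_∣ (⊆-antisym (p∩q⊆p N K) λ i∈ → x∈p∩q⁺ (i∈ , N⊆K i∈)) ⟩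
    ∣ N ∣                               ≡⟨ ∣N∣≡k ⟩
    k                                   ∎
    where open ≡-Reasoning

  lift-shares : ∀ {Q Q′} → Shares k Q Q′ → Shares k (lift Q) (lift Q′)
  lift-shares {Q} {Q′} eq =
    trans (cong ∣_∣ (insertAt-∩ Q Q′ v outside outside)) (trans (∣insertAt-outside∣ (Q ∩ Q′) v) eq)

  listed⁺ : ∀ {Q} → KClique k G Q → Q ∈ˡ (X ∷ map lift L)
  listed⁺ {Q} (c , size) with insert-split v Q
  ... | Q′ , inj₁ refl = here (cong (λ p → insertAt p v inside)
          (p⊆q∧∣p∣≡∣q∣⇒p≡q (λ i∈ → proj₁ (nbr _) (clique-inside⁻ G v c i∈))
            (trans (ℕ.suc-injective (trans (≡-sym (∣insertAt-inside∣ Q′ v)) size)) (≡-sym ∣N∣≡k))))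
  ... | Q′ , inj₂ refl = there (Membership.∈-map⁺ lift
          (listed (clique-delete G v c , trans (≡-sym (∣insertAt-outside∣ Q′ v)) size)))

  sound⁺ : ∀ {Q} → Q ∈ˡ (X ∷ map lift L) → KClique k G Q
  sound⁺ (here refl) = clique-inside⁺ G v cN (λ i∈ → proj₂ (nbr _) i∈) , trans (∣insertAt-inside∣ N v) (cong suc ∣N∣≡k)
  sound⁺ (there Q∈) with Membership.∈-map⁻ lift Q∈
  ... | Q′ , Q′∈ , refl = let (c , size) = sound Q′∈ in clique-outside⁺ G v c , trans (∣insertAt-outside∣ Q′ v) size

-- Counting edge sets

≐-decSetoid : ℕ → DecSetoid 0ℓ 0ℓ
≐-decSetoid n = record
  { Carrier = EdgeSet n
  ; _≈_     = _≐_
  ; isDecEquivalence = record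
    { isEquivalence = record
      { refl  = λ _ _ → refl
      ; sym   = λ eq p q → ≡-sym (eq p q)
      ; trans = λ eq eq′ p q → trans (eq p q) (eq′ p q) }
    ; _≟_ = λ T T′ → allSubset? λ p → allSubset? λ q → T p q Bool.≟ T′ p q } }

module _ {A : Set} where

  join : ∀ {n} → (Subset n → A) → (Subset n → A) → Subset (suc n) → A
  join f g (false ∷ p) = f p
  join f g (true ∷ p)  = g p

  functions : ∀ n → List A → List (Subset n → A)
  functions zero    as = map (λ a _ → a) as
  functions (suc n) as = cartesianProductWith join (functions n as) (functions n as)

  -- The relation is a parameter so that the lemma applies twice: with equality to the rows of an
  -- edge set, then with pointwise equality of rows to the edge set itself.
  functions-complete : (_~_ : A → A → Set) → ∀ n {as} (f : Subset n → A) → (∀ p → Any (f p ~_) as) →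
                       Any (λ g → ∀ p → f p ~ g p) (functions n as)
  functions-complete _~_ zero    f cover = Any.map⁺ (Any.map (λ { r [] → r }) (cover []))
  functions-complete _~_ (suc n) f cover =
    Any.cartesianProductWith⁺ join (λ { r s (false ∷ p) → r p ; r s (true ∷ p) → s p })
      (functions-complete _~_ n (f ∘ (outside ∷_)) (cover ∘ (outside ∷_)))
      (functions-complete _~_ n (f ∘ (inside ∷_)) (cover ∘ (inside ∷_)))

allEdgeSets : ∀ n → List (EdgeSet n)
allEdgeSets n = functions n (functions n (false ∷ true ∷ []))

allEdgeSets-complete : ∀ {n} (T : EdgeSet n) → Any (T ≐_) (allEdgeSets n)
allEdgeSets-complete {n} T = functions-complete (λ f g → ∀ q → f q ≡ g q) n T λ p → functions-complete _≡_ n (T p) λ q → bool (T p q)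
  where
  bool : ∀ b → Any (b ≡_) (false ∷ true ∷ [])
  bool false = here refl
  bool true  = there (here refl)

-- The witness is the list of all edge sets, filtered by P and freed of repetitions. That list
-- contains T only up to `_≐_`, so P has to respect it.
hasCount : ∀ {n} {P : EdgeSet n → Set} → Decidable P → (∀ {T T′} → T ≐ T′ → P T → P T′) → ∃ (HasCount P)
hasCount {n} P? resp = -, L , refl , All.deduplicate⁺ _≟_ (All.all-filter P? (allEdgeSets n)) ,
  deduplicate-! (≐-decSetoid n) _ ,
  λ T PT → SetoidMembership.∈-deduplicate⁺ setoid _≟_ (λ eq eq′ → DecSetoid.trans DS eq′ (DecSetoid.sym DS eq))
    (SetoidMembership.∈-filter⁺ setoid P? resp (allEdgeSets-complete T) PT)
  where
  DS = ≐-decSetoid n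
  open DecSetoid DS using (setoid; _≟_)
  L = deduplicate _≟_ (filter P? (allEdgeSets n))

hasCount-resp : ∀ {n} {P P′ : EdgeSet n → Set} → (∀ {T} → P T → P′ T) → (∀ {T} → P′ T → P T) →
                ∀ {c} → HasCount P c → HasCount P′ c
hasCount-resp P⇒P′ P′⇒P (L , len , sound , distinct , complete) =
  L , len , All.map P⇒P′ sound , distinct , λ T → complete T ∘ P′⇒P

module _ {n} {Vtx : Subset n → Set} where

  tree? : Decidable Vtx → ∀ T → Dec (IsTree Vtx (TEdge T))
  tree? Vtx? T = map′
    (λ { (a , b , c , d , e) → mkTree (a _ _) (b _ _) (c _) (d _ _) (e _ _ _) })
    (λ { (mkTree a b c d e) → (λ _ _ → a) , (λ _ _ → b) , (λ _ → c) , (λ _ _ → d) , (λ _ _ _ → e) })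
    (  (allSubset? λ p → allSubset? λ q → tedge? T p q →-dec Vtx? p)
    ×-dec (allSubset? λ p → allSubset? λ q → tedge? T p q →-dec tedge? T q p)
    ×-dec (allSubset? λ p → ¬? (tedge? T p p))
    ×-dec (allSubset? λ p → allSubset? λ q → Vtx? p →-dec (Vtx? q →-dec starˢ? (tedge? T) p q))
    ×-dec (allSubset? λ z → allSubset? λ a → allSubset? λ b → tedge? T z a →-dec (tedge? T z b →-dec
             (¬? (a ≟ˢ b) →-dec ¬? (starˢ? (tedge? T ∖? (z ≟ˢ_)) a b)))))

  module _ {Adj : Subset n → Subset n → Set} {T : EdgeSet n} where

    spanningTree⇒tree : (∀ {p q} → Adj p q → Vtx p × p ≢ q) → IsSpanningTree Vtx Adj T → IsTree Vtx (TEdge T)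
    spanningTree⇒tree adj⇒ (edges , symT , conn , noCycle) = record
      { source    = λ e → proj₁ (adj⇒ (edges _ _ e))
      ; symmetric = symE
      ; irr       = irrE
      ; connected = λ Vp Vq → walk⇒star (proj₂ (conn _ _ Vp Vq))
      ; acyclic   = noCycle⇒acyclic symE _≟ˢ_ irrE noCycle
      }
      where
      symE : ∀ {p q} → TEdge T p q → TEdge T q p
      symE {p} {q} e = trans (symT q p) e
      irrE : ∀ {p} → ¬ TEdge T p p
      irrE e = proj₂ (adj⇒ (edges _ _ e)) refl

    tree⇒spanningTree : (∀ {p q} → TEdge T p q → Adj p q) → IsTree Vtx (TEdge T) → IsSpanningTree Vtx Adj T
    tree⇒spanningTree edges t = (λ _ _ → edges) , symT , (λ _ _ Vp Vq → star⇒walk (connected Vp Vq)) ,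
      acyclic⇒noCycle symmetric acyclic
      where
      open IsTree t
      symT : ∀ p q → T p q ≡ T q p
      symT p q with T p q in eq | T q p in eq′
      ... | true  | true  = refl
      ... | false | false = refl
      ... | true  | false = trans (≡-sym (symmetric eq)) eq′
      ... | false | true  = trans (≡-sym eq) (symmetric eq′)

-- Clique trees and the reduced clique graph of a k-tree

-- `Nonempty` matters for k = 0, where `Shares k` alone would join disjoint cliques.
Link : ∀ {n} → ℕ → Subset n → Subset n → Set
Link k Q Q′ = Nonempty (Q ∩ Q′) × Shares k Q Q′

IsLinkTree : ∀ {n} → ℕ → Graph n → EdgeSet n → Set
IsLinkTree k G T = (∀ Q Q′ → TEdge T Q Q′ → Link k Q Q′) × IsTree (KClique k G) (TEdge T)

kClique? : ∀ {n} k (G : Graph n) → Decidable (KClique k G)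
kClique? k G Q = (Fin.all? λ i → Fin.all? λ j →
    i ∈? Q →-dec (j ∈? Q →-dec (¬? (i Fin.≟ j) →-dec (adj G i j Bool.≟ true))))
  ×-dec (∣ Q ∣ ℕ.≟ suc k)

linkTree? : ∀ {n} k (G : Graph n) → Decidable (IsLinkTree k G)
linkTree? k G T =
  (allSubset? λ Q → allSubset? λ Q′ → tedge? T Q Q′ →-dec (nonempty? (Q ∩ Q′) ×-dec (∣ Q ∩ Q′ ∣ ℕ.≟ k)))
  ×-dec tree? (kClique? k G) T

linkTree-resp : ∀ {n} k (G : Graph n) {T T′} → T ≐ T′ → IsLinkTree k G T → IsLinkTree k G T′
linkTree-resp k G eq (links , t) =
  (λ Q Q′ e → links Q Q′ (trans (eq Q Q′) e)) ,
  tree-resp id id (λ {Q} {Q′} e → trans (≡-sym (eq Q Q′)) e) (λ {Q} {Q′} e → trans (eq Q Q′) e) t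

module _ {k n} {G : Graph n} (kt : IsKTree k G) where

  ∣kClique∩kClique∣≤k : ∀ {Q Q′} → KClique k G Q → KClique k G Q′ → Q ≢ Q′ → ∣ Q ∩ Q′ ∣ ≤ k
  ∣kClique∩kClique∣≤k {Q} {Q′} (_ , size) (_ , size′) Q≢Q′ with ∣ Q ∩ Q′ ∣ ℕ.≤? k
  ... | yes le = le
  ... | no  gt = contradiction (p⊆q∧∣p∣≡∣q∣⇒p≡q Q⊆Q′ (trans size (≡-sym size′))) Q≢Q′
    where
    Q⊆Q′ : Q ⊆ Q′
    Q⊆Q′ x∈ = p∩q⊆q Q Q′ (p⊆q∧∣q∣≤∣p∣⇒q⊆p (p∩q⊆p Q Q′) (subst (_≤ ∣ Q ∩ Q′ ∣) (≡-sym size) (ℕ.≰⇒> gt)) x∈)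

  private
    build  = proj₁ (proj₂ (kCliques-built kt))
    listed = proj₁ (proj₂ (proj₂ (kCliques-built kt)))
    sound  = proj₂ (proj₂ (proj₂ (kCliques-built kt)))

  -- Serves twice: as a chain of cliques along which small sets are bypassed, and as a competitor of
  -- weight k on every edge.
  kTree : EdgeSet n
  kTree Q Q′ = does (builtEdge? _≟ˢ_ build Q Q′)

  kTree-edge : ∀ {Q Q′} → TEdge kTree Q Q′ → BuiltEdge build Q Q′
  kTree-edge {Q} {Q′} e with builtEdge? _≟ˢ_ build Q Q′
  ... | yes b = b
  ... | no  _ = contradiction e λ ()

  kTree-shares : ∀ {Q Q′} → TEdge kTree Q Q′ → Shares k Q Q′
  kTree-shares e = builtEdge⇒Adj (λ {Q} {Q′} eq → trans (cong ∣_∣ (∩-comm Q′ Q)) eq) build (kTree-edge e)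

  kTree-tree : IsTree (KClique k G) (TEdge kTree)
  kTree-tree = tree-resp sound listed (dec-true (builtEdge? _≟ˢ_ build _ _)) kTree-edge (built-tree _≟ˢ_ build)

  -- Each consecutive pair of cliques on the walk shares k > ∣ X ∣ vertices.
  linked-outside : ∀ {X Q Q′ x y} → ∣ X ∣ < k → KClique k G Q → Star (TEdge kTree) Q Q′ →
                   x ∈ Q → x ∉ X → y ∈ Q′ → y ∉ X → Star (Edge G ∖ (_∈ X)) x y
  linked-outside {X} {Q} {x = x} {y} lt (c , _) s x∈ x∉ y∈ y∉ = go s
    where
    hop : ∀ {z} → z ∈ Q → z ∉ X → Star (Edge G ∖ (_∈ X)) x z
    hop {z} z∈ z∉ with x Fin.≟ z
    ... | yes refl = ε
    ... | no  x≢z  = (c x z x∈ z∈ x≢z , x∉ , z∉) ◅ ε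
    go : Star (TEdge kTree) Q _ → Star (Edge G ∖ (_∈ X)) x y
    go ε = hop y∈ y∉
    go (_◅_ {j = Q₁} e s) with ∣p∣<∣q∣⇒∃∈q∉p X (Q ∩ Q₁) (subst (∣ X ∣ <_) (≡-sym (kTree-shares e)) lt)
    ... | z , z∈ , z∉ with x∈p∩q⁻ Q Q₁ z∈
    ...   | z∈Q , z∈Q₁ = hop z∈Q z∉ ◅◅
              linked-outside lt (IsTree.source kTree-tree (IsTree.symmetric kTree-tree e)) s z∈Q₁ z∉ y∈ y∉

  -- If fewer than k vertices are shared, `linked-outside` leads from Q to Q′ around the
  -- intersection. The walk is shortened to a path because `SeparatingPair` speaks of paths only.
  separating⇒shares : ∀ {Q Q′} → KClique k G Q → KClique k G Q′ → Q ≢ Q′ → SeparatingPair G Q Q′ → Shares k Q Q′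
  separating⇒shares {Q} {Q′} kQ kQ′ Q≢Q′ (_ , sep) with ℕ.m≤n⇒m<n∨m≡n (∣kClique∩kClique∣≤k kQ kQ′ Q≢Q′)
  ... | inj₂ eq = eq
  ... | inj₁ lt
    with ∣p∣<∣q∣⇒∃∈q∉p (Q ∩ Q′) Q (subst (∣ Q ∩ Q′ ∣ <_) (≡-sym (proj₂ kQ)) (ℕ.m≤n⇒m≤1+n lt))
       | ∣p∣<∣q∣⇒∃∈q∉p (Q ∩ Q′) Q′ (subst (∣ Q ∩ Q′ ∣ <_) (≡-sym (proj₂ kQ′)) (ℕ.m≤n⇒m≤1+n lt))
  ... | x , x∈ , x∉ | y , y∈ , y∉
    with star⇒path∖ Fin._≟_ x∉ (linked-outside lt kQ (IsTree.connected kTree-tree kQ kQ′) x∈ x∉ y∈ y∉)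
  ... | vs , path , avoids = contradiction
          (sep x y vs x∈ (λ x∈′ → x∉ (x∈p∩q⁺ (x∈ , x∈′))) y∈ (λ y∈′ → y∉ (x∈p∩q⁺ (y∈′ , y∈))) path)
          (All.All¬⇒¬Any avoids)

  shares⇒separating : ∀ {Q Q′} → KClique k G Q → KClique k G Q′ → Link k Q Q′ → SeparatingPair G Q Q′
  shares⇒separating {Q} {Q′} (c , _) (c′ , _) (nonempty , shares) = nonempty , sep
    where
    sep : ∀ x y vs → x ∈ Q → x ∉ Q′ → y ∈ Q′ → y ∉ Q → Path (Edge G) x y vs → Any (_∈ (Q ∩ Q′)) vs
    sep x y vs x∈ x∉ y∈ y∉ (w , _) with Any.any? (_∈? (Q ∩ Q′)) vs
    ... | yes meets = meets
    ... | no  avoids = ⊥-elim (separates kt shares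
            (λ i j i∈ j∈ → c i j (p∩q⊆p Q Q′ i∈) (p∩q⊆p Q Q′ j∈))
            (x∉ ∘ p∩q⊆q Q Q′) (y∉ ∘ p∩q⊆p Q Q′) (λ { refl → y∉ x∈ })
            (λ s∈ → c _ _ (p∩q⊆p Q Q′ s∈) x∈ λ { refl → x∉ (p∩q⊆q Q Q′ s∈) })
            (λ s∈ → c′ _ _ (p∩q⊆q Q Q′ s∈) y∈ λ { refl → y∉ (p∩q⊆p Q Q′ s∈) })
            (walk⇒star∖ w (All.¬Any⇒All¬ vs avoids)))

  private
    kMax = kClique⇒maxClique kt
    maxK = maxClique⇒kClique kt

    max⇒kTree : ∀ {R} → IsTree (IsMaxClique G) R → IsTree (KClique k G) R
    max⇒kTree = tree-resp maxK kMax id id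

    k⇒maxTree : ∀ {R} → IsTree (KClique k G) R → IsTree (IsMaxClique G) R
    k⇒maxTree = tree-resp kMax maxK id id

  module _ {T : EdgeSet n} (t : IsTree (KClique k G) (TEdge T)) where
    open IsTree t

    tree-edge⁻ : ∀ {Q Q′} → TEdge T Q Q′ → KClique k G Q × KClique k G Q′ × Q ≢ Q′
    tree-edge⁻ e = source e , source (symmetric e) , λ { refl → irr e }

    tree-edge-≤ : ∀ Q Q′ → TEdge T Q Q′ → ∣ Q ∩ Q′ ∣ ≤ k
    tree-edge-≤ _ _ e = let (kQ , kQ′ , Q≢Q′) = tree-edge⁻ e in ∣kClique∩kClique∣≤k kQ kQ′ Q≢Q′

    ciSpanning : (∀ {Q Q′} → TEdge T Q Q′ → Nonempty (Q ∩ Q′)) → IsSpanningTree (IsMaxClique G) (CIAdj G) T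
    ciSpanning ne = tree⇒spanningTree
      (λ e → let (kQ , kQ′ , Q≢Q′) = tree-edge⁻ e in kMax kQ , kMax kQ′ , Q≢Q′ , ne e) (k⇒maxTree t)

  edgeCount-≡ : ∀ {T T′} → IsTree (KClique k G) (TEdge T) → IsTree (KClique k G) (TEdge T′) → edgeCount T ≡ edgeCount T′
  -- A (k+1)-clique extending the empty clique serves as the root.
  edgeCount-≡ {T} {T′} = edgeCount-unique (kClique? k G) (_ , proj₁ (proj₂ (clique-extends kt ∅-clique))) {T} {T′}
    where
    ∅-clique : IsClique G ∅
    ∅-clique i j i∈ = contradiction i∈ ∉⊥

  crTree⇒linkTree : ∀ {T} → IsCrSpanningTree G T → IsLinkTree k G T
  crTree⇒linkTree st@(edges , _) = (λ Q Q′ e → link (edges Q Q′ e)) ,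
    max⇒kTree (spanningTree⇒tree (λ { (mQ , _ , Q≢Q′ , _) → mQ , Q≢Q′ }) st)
    where
    link : ∀ {Q Q′} → CrAdj G Q Q′ → Link k Q Q′
    link (mQ , mQ′ , Q≢Q′ , sep) = proj₁ sep , separating⇒shares (maxK mQ) (maxK mQ′) Q≢Q′ sep

  linkTree⇒crTree : ∀ {T} → IsLinkTree k G T → IsCrSpanningTree G T
  linkTree⇒crTree {T} (links , t) = tree⇒spanningTree
    (λ e → let (kQ , kQ′ , Q≢Q′) = tree-edge⁻ {T} t e in
      kMax kQ , kMax kQ′ , Q≢Q′ , shares⇒separating kQ kQ′ (links _ _ e))
    (k⇒maxTree t)

  linkTree⇒cliqueTree : ∀ {T} → IsLinkTree k G T → IsCliqueTree G T
  linkTree⇒cliqueTree {T} (links , t) = ciSpanning {T} t (λ e → proj₁ (links _ _ e)) , maximum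
    where
    maximum : ∀ T′ → IsSpanningTree (IsMaxClique G) (CIAdj G) T′ → weight2 T′ ≤ weight2 T
    maximum T′ st = begin
      weight2 T′          ≤⟨ weight2-≤ k T′ (tree-edge-≤ {T′} t′) ⟩
      k * edgeCount T′    ≡⟨ cong (k *_) (edgeCount-≡ {T′} {T} t′ t) ⟩
      k * edgeCount T     ≡⟨ weight2-const k T (λ Q Q′ e → proj₂ (links Q Q′ e)) ⟨
      weight2 T           ∎
      where
      open ℕ.≤-Reasoning
      t′ = max⇒kTree (spanningTree⇒tree (λ { (mQ , _ , Q≢Q′ , _) → mQ , Q≢Q′ }) st)

  cliqueTree⇒linkTree : ∀ {T} → IsCliqueTree G T → IsLinkTree k G T
  cliqueTree⇒linkTree {T} (st@(edges , _) , maximum) = links , t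
    where
    t = max⇒kTree (spanningTree⇒tree (λ { (mQ , _ , Q≢Q′ , _) → mQ , Q≢Q′ }) st)

    links : ∀ Q Q′ → TEdge T Q Q′ → Link k Q Q′
    links Q Q′ e with edges Q Q′ e | ℕ.m≤n⇒m<n∨m≡n (tree-edge-≤ {T} t Q Q′ e)
    ... | _ , _ , _ , ne | inj₂ eq = ne , eq
    ... | _              | inj₁ lt = contradiction (maximum kTree kTree-ci) (ℕ.<⇒≱ heavier)
      where
      kTree-ci : IsSpanningTree (IsMaxClique G) (CIAdj G) kTree
      -- `lt` forces k ≥ 1, so cliques sharing k vertices do meet and `kTree` lies in the
      -- clique-intersection graph.
      kTree-ci = ciSpanning {kTree} kTree-tree λ {P} {P′} e →
        let (x , x∈ , _) = ∣p∣<∣q∣⇒∃∈q∉p ∅ (P ∩ P′)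
              (subst₂ _<_ (≡-sym (∣⊥∣≡0 n)) (≡-sym (kTree-shares e)) (ℕ.≤-<-trans z≤n lt))
        in x , x∈
      open ℕ.≤-Reasoning
      heavier : weight2 T < weight2 kTree
      heavier = begin-strict
        weight2 T              <⟨ weight2-< k T (tree-edge-≤ {T} t) Q Q′ e lt ⟩
        k * edgeCount T        ≡⟨ cong (k *_) (edgeCount-≡ {T} {kTree} t kTree-tree) ⟩
        k * edgeCount kTree    ≡⟨ weight2-const k kTree (λ _ _ → kTree-shares) ⟨
        weight2 kTree          ∎

theorem11 : ∀ (k n : ℕ) (G : Graph n) → IsKTree k G →
    ∃ λ c → HasCount (IsCliqueTree G) c × HasCount (IsCrSpanningTree G) c
theorem11 k n G kt =
  let (c , count) = hasCount (linkTree? k G) (linkTree-resp k G) in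
  c , hasCount-resp (linkTree⇒cliqueTree kt) (cliqueTree⇒linkTree kt) count
    , hasCount-resp (linkTree⇒crTree kt) (crTree⇒linkTree kt) count
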